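{- For every $k\ge 4$ and all $x_1,x_2\ge 0$ with $x_1+x_2\le 1$, $C_k(x_1,x_2)\le C_{k+1}(x_1,x_2)$.
   Context: The $k$-simplex is $\{x\in\mathbb{R}^k: x\ge 0,\ \sum_i x_i=1\}$. Let $F(z)=\min\{(11/6)z,1\}$ for $z\in[0,1]$, and let $F'(z)=11/6$ for $z\in[0,6/11]$ and $F'(z)=0$ otherwise. For a point $(x_1,\dots,x_k)$ of the $k$-simplex define $$d_k(x_1,\ldots,x_k)=\frac{1}{k!}\sum_{\sigma}\Big(F'(x_1)\prod_{i:\sigma(i)<\sigma(1)}[1-F(x_i)]+F'(x_2)\prod_{i:\sigma(i)<\sigma(2)}[1-F(x_i)]\Big),$$ the sum being over all permutations $\sigma$ of $\{1,\dots,k\}$. For $k\ge 3$ and $x_1,x_2\ge0$ with $x_1+x_2\le1$ define $C_k(x_1,x_2)=d_k(x_1,x_2,c,\ldots,c)$ where $c=(1-x_1-x_2)/(k-2)$. -}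

module Defs where

open import Level using (Level; _⊔_) renaming (suc to lsuc)
open import Algebra.Bundles using (CommutativeRing)
open import Algebra.Core using (Op₁; Op₂)
open import Algebra.Structures using (IsCommutativeRing)
open import Data.Bool.Base using (if_then_else_)
open import Data.Fin.Base using (Fin; zero; suc; punchIn)
open import Data.Fin.Permutation using (Permutation′; _⟨$⟩ʳ_; _≈_; insert; remove; insert-remove; insert-punchIn) renaming (id to idₚ)
open import Data.Fin.Properties using (_<?_; punchIn-injective)
open import Data.List.Base using (List; []; _∷_; allFin; concatMap; filter; foldr; map)
open import Data.List.Membership.Propositional.Properties using (∈-allFin)
open import Data.List.Relation.Unary.All as All using (All)
import Data.List.Relation.Unary.All.Properties as All
open import Data.List.Relation.Unary.AllPairs as AllPairs using (AllPairs; []; _∷_)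
import Data.List.Relation.Unary.AllPairs.Properties as AllPairs
open import Data.List.Relation.Unary.Any as Any using (Any; here)
import Data.List.Relation.Unary.Any.Properties as Any
open import Data.List.Relation.Unary.Unique.Propositional.Properties using (allFin⁺)
open import Data.Nat.Base as ℕ using (ℕ; s≤s; _!)
open import Data.Product.Base using (∃; _×_; _,_)
open import Data.Vec.Functional using (Vector; replicate) renaming (_∷_ to _∷ᵛ_)
open import Relation.Binary.Bundles using (DecTotalOrder)
open import Relation.Binary.Core using (Rel)
open import Relation.Binary.PropositionalEquality using (_≢_; refl; sym; trans; cong; module ≡-Reasoning)
open import Relation.Binary.Structures using (IsDecTotalOrder)
open import Relation.Nullary using (¬_; does)
open import Relation.Unary using (Pred)
import Algebra.Construct.NaturalChoice.Min as NaturalMin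
import Algebra.Definitions.RawMonoid as RawMonoidDefs

------------------------------------------------------------------------
-- The real numbers

-- _⁻¹ is total; its value at 0# is left unspecified.
record OrderedField (c ℓ₁ ℓ₂ : Level) : Set (lsuc (c ⊔ ℓ₁ ⊔ ℓ₂)) where
  infix  8 _⁻¹
  infix  8 -_
  infixl 7 _*_
  infixl 6 _+_
  infix  4 _≋_ _≤_
  field
    Carrier           : Set c
    _≋_               : Rel Carrier ℓ₁
    _≤_               : Rel Carrier ℓ₂
    _+_ _*_           : Op₂ Carrier
    -_ _⁻¹            : Op₁ Carrier
    0# 1#             : Carrier
    isCommutativeRing : IsCommutativeRing _≋_ _+_ _*_ -_ 0# 1#
    isDecTotalOrder   : IsDecTotalOrder _≋_ _≤_
    ⁻¹-cong           : ∀ {x y} → x ≋ y → x ⁻¹ ≋ y ⁻¹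
    *-inverseʳ        : ∀ x → ¬ x ≋ 0# → x * x ⁻¹ ≋ 1#
    0≉1               : ¬ 0# ≋ 1#
    +-monoˡ-≤         : ∀ z {x y} → x ≤ y → x + z ≤ y + z
    *-nonNeg          : ∀ {x y} → 0# ≤ x → 0# ≤ y → 0# ≤ x * y

  commutativeRing : CommutativeRing c ℓ₁
  commutativeRing = record { isCommutativeRing = isCommutativeRing }

  decTotalOrder : DecTotalOrder c ℓ₁ ℓ₂
  decTotalOrder = record { isDecTotalOrder = isDecTotalOrder }

  open CommutativeRing commutativeRing public using (_-_; +-rawMonoid)
  open DecTotalOrder decTotalOrder public using (_≤?_; totalOrder)
  open NaturalMin totalOrder public using (_⊓_)
  open RawMonoidDefs +-rawMonoid using () renaming (_×_ to _×′_)

  fromℕ : ℕ → Carrier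
  fromℕ n = n ×′ 1#

  infixl 7 _/_
  _/_ : Op₂ Carrier
  x / y = x * y ⁻¹

  Σ[_] : ∀ {a} {A : Set a} → List A → (A → Carrier) → Carrier
  Σ[ xs ] f = foldr _+_ 0# (map f xs)

  Π[_] : ∀ {a} {A : Set a} → List A → (A → Carrier) → Carrier
  Π[ xs ] f = foldr _*_ 1# (map f xs)

-- The library has no real numbers, so ℝ is characterised axiomatically, as the
-- Dedekind-complete ordered field (unique up to isomorphism). The order is
-- decidable because F′ below is defined by cases on it; a model therefore
-- needs classical principles, as ℝ does in classical analysis.
record Reals (c ℓ₁ ℓ₂ : Level) : Set (lsuc (c ⊔ ℓ₁ ⊔ ℓ₂)) where
  field
    orderedField : OrderedField c ℓ₁ ℓ₂

  open OrderedField orderedField public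

  IsUpperBound : Pred Carrier (c ⊔ ℓ₁ ⊔ ℓ₂) → Carrier → Set (c ⊔ ℓ₁ ⊔ ℓ₂)
  IsUpperBound P b = ∀ x → P x → x ≤ b

  field
    complete : (P : Pred Carrier (c ⊔ ℓ₁ ⊔ ℓ₂)) → ∃ P → ∃ (IsUpperBound P) →
               ∃ λ s → IsUpperBound P s × (∀ b → IsUpperBound P b → s ≤ b)

------------------------------------------------------------------------
-- Enumeration of the permutations of Fin k

-- A permutation of Fin (suc k) is given by the image j of zero together with a
-- bijection between the remaining elements.
permutations : (k : ℕ) → List (Permutation′ k)
permutations ℕ.zero    = idₚ ∷ []
permutations (ℕ.suc k) = concatMap (λ j → map (insert zero j) (permutations k)) (allFin (ℕ.suc k))

-- The two facts below say that each permutation is listed exactly once, where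
-- permutations are compared pointwise.
permutations-complete : ∀ k (π : Permutation′ k) → Any (π ≈_) (permutations k)
permutations-complete ℕ.zero    π = here (λ ())
permutations-complete (ℕ.suc k) π =
  Any.concatMap⁺ _ (Any.map
    (λ { refl → Any.map⁺ (Any.map step (permutations-complete k (remove zero π))) })
    (∈-allFin (π ⟨$⟩ʳ zero)))
  where
  step : ∀ {ρ} → remove zero π ≈ ρ → π ≈ insert zero (π ⟨$⟩ʳ zero) ρ
  step eq zero    = refl
  step {ρ} eq (suc i) = begin
    π ⟨$⟩ʳ suc i                                              ≡⟨ insert-remove zero π (suc i) ⟨
    insert zero (π ⟨$⟩ʳ zero) (remove zero π) ⟨$⟩ʳ suc i      ≡⟨ insert-punchIn zero _ (remove zero π) i ⟩
    punchIn (π ⟨$⟩ʳ zero) (remove zero π ⟨$⟩ʳ i)              ≡⟨ cong (punchIn _) (eq i) ⟩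
    punchIn (π ⟨$⟩ʳ zero) (ρ ⟨$⟩ʳ i)                          ≡⟨ insert-punchIn zero _ ρ i ⟨
    insert zero (π ⟨$⟩ʳ zero) ρ ⟨$⟩ʳ suc i                    ∎
    where open ≡-Reasoning

permutations-distinct : ∀ k → AllPairs (λ π ρ → ¬ π ≈ ρ) (permutations k)
permutations-distinct ℕ.zero    = All.[] ∷ []
permutations-distinct (ℕ.suc k) = AllPairs.concat⁺
  (All.map⁺ (All.universal (λ j → AllPairs.map⁺ (AllPairs.map (tail j) (permutations-distinct k))) _))
  (AllPairs.map⁺ (AllPairs.map head (allFin⁺ (ℕ.suc k))))
  where
  tail : ∀ j {π ρ : Permutation′ k} → ¬ π ≈ ρ → ¬ insert zero j π ≈ insert zero j ρ
  tail j {π} {ρ} π≉ρ eq = π≉ρ λ i → punchIn-injective j _ _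
    (trans (sym (insert-punchIn zero j π i)) (trans (eq (suc i)) (insert-punchIn zero j ρ i)))

  head : ∀ {i j} → i ≢ j →
         All (λ π → All (λ ρ → ¬ π ≈ ρ) (map (insert zero j) (permutations k)))
             (map (insert zero i) (permutations k))
  head i≢j = All.map⁺ (All.universal (λ _ → All.map⁺ (All.universal (λ _ eq → i≢j (eq zero)) _)) _)

------------------------------------------------------------------------
-- The functions F, F′, d and C

module _ {c ℓ₁ ℓ₂ : Level} (K : OrderedField c ℓ₁ ℓ₂) where
  open OrderedField K

  F : Carrier → Carrier
  F z = (fromℕ 11 / fromℕ 6 * z) ⊓ 1#

  -- Only used on [0,1], so the lower bound 0 ≤ z is not tested.
  F′ : Carrier → Carrier
  F′ z = if does (z ≤? fromℕ 6 / fromℕ 11) then fromℕ 11 / fromℕ 6 else 0#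

  -- The product of 1 - F(xᵢ) over all i with σ(i) < σ(j).
  before : ∀ {k} → Vector Carrier k → Permutation′ k → Fin k → Carrier
  before {k} x σ j = Π[ filter (λ i → (σ ⟨$⟩ʳ i) <? (σ ⟨$⟩ʳ j)) (allFin k) ] λ i → 1# - F (x i)

  -- The indices 1 and 2 are zero and suc zero, so k is written 2 + n.
  d : ∀ {n} → Vector Carrier (2 ℕ.+ n) → Carrier
  d {n} x = 1# / fromℕ ((2 ℕ.+ n) !) *
    Σ[ permutations (2 ℕ.+ n) ] λ σ →
      F′ (x zero) * before x σ zero + F′ (x (suc zero)) * before x σ (suc zero)

  C : (k : ℕ) → 3 ℕ.≤ k → Carrier → Carrier → Carrier
  C (ℕ.suc ℕ.zero) (s≤s ())
  C (ℕ.suc (ℕ.suc n)) _ x₁ x₂ = d (x₁ ∷ᵛ x₂ ∷ᵛ replicate n ((1# - x₁ - x₂) / fromℕ n))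

{-# OPTIONS --safe #-}

-- Write uᵢ = 1 − F(xᵢ). Averaged over all orders, the product of the uᵢ with i before a marked
-- element is a symmetric multi-affine polynomial in the uᵢ with nonnegative coefficients, and it
-- does not change when an element with u = 1 is added. Hence C_k compares (v, q, …, q, 1) with
-- (v, q̄, …, q̄), where q = 1 − F(s/n), q̄ = 1 − F(s/(n+1)), s = 1 − x₁ − x₂ and n = k − 2. As
-- n ≥ 2, F is linear at s/n, so q̄ is the mean of q, …, q, 1. Moving two entries towards each
-- other keeps their sum and increases their product, so averaging can only increase the value.

module Submission where

open import Defs
open import Algebra.Bundles using (CommutativeRing)
import Algebra.Construct.NaturalChoice.Min as NaturalMin
import Algebra.Construct.NaturalChoice.MinOp as MinOp
import Algebra.Properties.Ring as RingProperties
import Algebra.Properties.Semiring.Mult as SemiringMult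
import Algebra.Solver.Ring.NaturalCoefficients.Default as SemiringSolver
open import Data.Bool.Base using (true; false; if_then_else_)
open import Data.Fin.Base using (Fin; zero; suc; toℕ; punchIn)
open import Data.Fin.Permutation using (Permutation′; _⟨$⟩ʳ_; insert; insert-punchIn)
open import Data.Fin.Properties using (toℕ≤pred[n])
open import Data.List.Base using (List; []; _∷_; _++_; allFin; concatMap; filter; foldr; map; upTo)
open import Data.List.Properties using (map-tabulate; map-applyUpTo; map-upTo)
open import Data.Nat.Base as ℕ using (ℕ; suc; s≤s; z≤n; pred; _∸_; _<ᵇ_; _!)
open import Data.Nat.Properties using (<⇒≤; m≤n⇒m≤1+n; +-∸-assoc; ≤-refl; n∸n≡0; m≤m+n; +-suc)
open import Data.Sum.Base using (inj₁; inj₂)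
open import Data.Vec.Functional using (Vector; replicate; head; tail) renaming (_∷_ to _∷ᵛ_)
open import Function.Base using (id; _∘_)
open import Level using (Level)
open import Relation.Binary.Bundles using (DecTotalOrder)
open import Relation.Binary.PropositionalEquality as ≡ using (_≡_)
import Relation.Binary.Reasoning.PartialOrder as POReasoning
import Relation.Binary.Reasoning.Setoid as SetoidReasoning
open import Relation.Nullary using (¬_; does)
open import Relation.Unary using (Decidable)

-- Positions after the insertion of one element into an order.

<ᵇ-irrefl : ∀ n → (n <ᵇ n) ≡ false
<ᵇ-irrefl ℕ.zero  = ≡.refl
<ᵇ-irrefl (suc n) = <ᵇ-irrefl n

-- If the inserted element takes one of the first l places, only l - 1 of them remain for the other
-- elements; otherwise all l remain. In the first case l is positive, so `pred` is a true
-- predecessor.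
punchIn-<ᵇ : ∀ {n} (m : Fin (suc n)) (p : Fin n) l →
  (toℕ (punchIn m p) <ᵇ l) ≡ (if toℕ m <ᵇ l then toℕ p <ᵇ pred l else toℕ p <ᵇ l)
punchIn-<ᵇ m       p       ℕ.zero        = ≡.refl
punchIn-<ᵇ zero    p       (suc l)       = ≡.refl
punchIn-<ᵇ (suc m) zero    (suc ℕ.zero)  = ≡.refl
punchIn-<ᵇ (suc m) zero    (suc (suc l)) with toℕ m <ᵇ suc l
... | true  = ≡.refl
... | false = ≡.refl
punchIn-<ᵇ (suc m) (suc p) (suc ℕ.zero)  = ≡.refl
punchIn-<ᵇ (suc m) (suc p) (suc (suc l)) = punchIn-<ᵇ m p (suc l)

-- Inserting at place p itself already pushes the old element up to p + 1, which accounts for the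
-- `suc`.
self-<ᵇ-punchIn : ∀ {n} (m : Fin (suc n)) (p : Fin n) →
  (toℕ m <ᵇ toℕ (punchIn m p)) ≡ (toℕ m <ᵇ suc (toℕ p))
self-<ᵇ-punchIn zero    p       = ≡.refl
self-<ᵇ-punchIn (suc m) zero    = ≡.refl
self-<ᵇ-punchIn (suc m) (suc p) = self-<ᵇ-punchIn m p

toℕ-punchIn : ∀ {n} (m : Fin (suc n)) (p : Fin n) →
  toℕ (punchIn m p) ≡ (if toℕ m <ᵇ suc (toℕ p) then suc (toℕ p) else toℕ p)
toℕ-punchIn zero    p       = ≡.refl
toℕ-punchIn (suc m) zero    = ≡.refl
toℕ-punchIn (suc m) (suc p) rewrite toℕ-punchIn m p with toℕ m <ᵇ suc (toℕ p)
... | true  = ≡.refl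
... | false = ≡.refl

suc-∸ : ∀ {l n} → l ℕ.≤ n → suc n ∸ l ≡ suc (n ∸ l)
suc-∸ l≤n = +-∸-assoc 1 l≤n

module OrderedFieldProperties {c ℓ₁ ℓ₂ : Level} (K : OrderedField c ℓ₁ ℓ₂) where
  open OrderedField K
  open CommutativeRing commutativeRing
    using (refl; sym; trans; reflexive; setoid; +-cong; +-congˡ; +-congʳ; *-cong; *-congˡ; *-congʳ
          ; +-identityʳ; +-identityˡ; *-identityˡ; *-identityʳ; zeroˡ; zeroʳ; distribˡ
          ; +-assoc; *-assoc; +-comm; *-comm; -‿cong; -‿inverseʳ; -‿inverseˡ
          ; ring; semiring; commutativeSemiring)
  open SemiringSolver commutativeSemiring using (solve; _:=_; _:+_; _:*_; con)
  open DecTotalOrder decTotalOrder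
    using (poset; total; ≤-respˡ-≈; ≤-respʳ-≈; antisym)
    renaming (reflexive to ≤-reflexive; refl to ≤-reflᴷ; trans to ≤-transᴷ)
  open RingProperties ring using (-‿distribˡ-*; -‿involutive)
  open SemiringMult semiring using (×1-homo-*)

  -- Arithmetic in an ordered field.

  ≤⇒0≤- : ∀ {x y} → x ≤ y → 0# ≤ y - x
  ≤⇒0≤- {x} x≤y = ≤-respˡ-≈ (-‿inverseʳ x) (+-monoˡ-≤ (- x) x≤y)

  x+[y-x]≋y : ∀ x y → x + (y - x) ≋ y
  x+[y-x]≋y x y = trans (solve 3 (λ x y z → x :+ (y :+ z) := y :+ (x :+ z)) refl x y (- x))
    (trans (+-congˡ (-‿inverseʳ x)) (+-identityʳ y))

  x+y≋z⇒x≋z-y : ∀ {x y z} → x + y ≋ z → x ≋ z - y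
  x+y≋z⇒x≋z-y {x} {y} {z} eq = begin
    x              ≈⟨ +-identityʳ x ⟨
    x + 0#         ≈⟨ +-congˡ (-‿inverseʳ y) ⟨
    x + (y - y)    ≈⟨ +-assoc x y (- y) ⟨
    x + y - y      ≈⟨ +-congʳ eq ⟩
    z - y          ∎
    where open SetoidReasoning setoid

  x≤x+e : ∀ {x e} → 0# ≤ e → x ≤ x + e
  x≤x+e {x} {e} 0≤e = ≤-respˡ-≈ (+-identityˡ x) (≤-respʳ-≈ (+-comm e x) (+-monoˡ-≤ x 0≤e))

  +-mono-≤ : ∀ {x y u v} → x ≤ y → u ≤ v → x + u ≤ y + v
  +-mono-≤ {x} {y} {u} {v} x≤y u≤v = ≤-transᴷ (+-monoˡ-≤ u x≤y)
    (≤-respˡ-≈ (+-comm u y) (≤-respʳ-≈ (+-comm v y) (+-monoˡ-≤ y u≤v)))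

  +-nonNeg : ∀ {x y} → 0# ≤ x → 0# ≤ y → 0# ≤ x + y
  +-nonNeg 0≤x 0≤y = ≤-transᴷ 0≤x (x≤x+e 0≤y)

  *-monoʳ-≤ : ∀ {x y z} → 0# ≤ z → x ≤ y → z * x ≤ z * y
  *-monoʳ-≤ {x} {y} {z} 0≤z x≤y = ≤-respʳ-≈
    (trans (sym (distribˡ z x (y - x))) (*-congˡ (x+[y-x]≋y x y)))
    (x≤x+e (*-nonNeg 0≤z (≤⇒0≤- x≤y)))

  *-monoˡ-≤ : ∀ {x y z} → 0# ≤ z → x ≤ y → x * z ≤ y * z
  *-monoˡ-≤ {x} {y} {z} 0≤z x≤y = ≤-respˡ-≈ (*-comm z x) (≤-respʳ-≈ (*-comm z y) (*-monoʳ-≤ 0≤z x≤y))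

  0≤1 : 0# ≤ 1#
  0≤1 with total 0# 1#
  ... | inj₁ 0≤1 = 0≤1
  ... | inj₂ 1≤0 = ≤-respʳ-≈ [-1]²≋1 (*-nonNeg 0≤-1 0≤-1)
    where
    0≤-1 : 0# ≤ - 1#
    0≤-1 = ≤-respʳ-≈ (+-identityˡ (- 1#)) (≤⇒0≤- 1≤0)
    [-1]²≋1 : - 1# * - 1# ≋ 1#
    [-1]²≋1 = trans (sym (-‿distribˡ-* 1# (- 1#)))
      (trans (-‿cong (*-identityˡ (- 1#))) (-‿involutive 1#))

  fromℕ-nonNeg : ∀ n → 0# ≤ fromℕ n
  fromℕ-nonNeg ℕ.zero  = ≤-reflᴷ
  fromℕ-nonNeg (suc n) = +-nonNeg 0≤1 (fromℕ-nonNeg n)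

  fromℕ-+ : ∀ m n → fromℕ (m ℕ.+ n) ≋ fromℕ m + fromℕ n
  fromℕ-+ ℕ.zero  n = sym (+-identityˡ _)
  fromℕ-+ (suc m) n = trans (+-congˡ (fromℕ-+ m n)) (sym (+-assoc _ _ _))

  fromℕ-mono : ∀ {m n} → m ℕ.≤ n → fromℕ m ≤ fromℕ n
  fromℕ-mono {n = n} z≤n = fromℕ-nonNeg n
  fromℕ-mono (s≤s m≤n)   = +-mono-≤ ≤-reflᴷ (fromℕ-mono m≤n)

  fromℕ-suc≉0 : ∀ n → ¬ fromℕ (suc n) ≋ 0#
  fromℕ-suc≉0 n eq = 0≉1 (antisym 0≤1 (≤-respʳ-≈ eq (x≤x+e (fromℕ-nonNeg n))))

  ⁻¹-nonNeg : ∀ {x} → 0# ≤ x → ¬ x ≋ 0# → 0# ≤ x ⁻¹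
  ⁻¹-nonNeg {x} 0≤x x≉0 with total 0# (x ⁻¹)
  ... | inj₁ 0≤x⁻¹ = 0≤x⁻¹
  ... | inj₂ x⁻¹≤0 with () ← 0≉1 (antisym 0≤1 (≤-respˡ-≈ (*-inverseʳ x x≉0)
          (≤-respʳ-≈ (zeroʳ x) (*-monoʳ-≤ 0≤x x⁻¹≤0))))

  fromℕ-suc⁻¹-nonNeg : ∀ n → 0# ≤ fromℕ (suc n) ⁻¹
  fromℕ-suc⁻¹-nonNeg n = ⁻¹-nonNeg (fromℕ-nonNeg (suc n)) (fromℕ-suc≉0 n)

  fromℕ-suc-inverseʳ : ∀ n → fromℕ (suc n) * fromℕ (suc n) ⁻¹ ≋ 1#
  fromℕ-suc-inverseʳ n = *-inverseʳ (fromℕ (suc n)) (fromℕ-suc≉0 n)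

  -- As `n !` is not syntactically a successor, this goes by induction: multiplying (n + 1) · n! = 0
  -- by the inverse of n + 1 gives n! = 0.
  fromℕ-!≉0 : ∀ n → ¬ fromℕ (n !) ≋ 0#
  fromℕ-!≉0 ℕ.zero    = fromℕ-suc≉0 0
  fromℕ-!≉0 (suc n) [1+n]!≋0 = fromℕ-!≉0 n (begin
    fromℕ (n !)                                            ≈⟨ *-identityˡ _ ⟨
    1# * fromℕ (n !)                                       ≈⟨ *-congʳ (fromℕ-suc-inverseʳ n) ⟨
    fromℕ (suc n) * fromℕ (suc n) ⁻¹ * fromℕ (n !)         ≈⟨ solve 3 (λ x y z → x :* y :* z := y :* (x :* z)) refl _ _ _ ⟩
    fromℕ (suc n) ⁻¹ * (fromℕ (suc n) * fromℕ (n !))       ≈⟨ *-congˡ (×1-homo-* (suc n) (n !)) ⟨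
    fromℕ (suc n) ⁻¹ * fromℕ (suc n !)                     ≈⟨ *-congˡ [1+n]!≋0 ⟩
    fromℕ (suc n) ⁻¹ * 0#                                  ≈⟨ zeroʳ _ ⟩
    0#                                                     ∎)
    where open SetoidReasoning setoid

  -- Brings the averages over the permutations of n and of n + 1 elements to the same denominator (n
  -- + 1)!.
  1/n!-expand : ∀ n x →
    1# / fromℕ (n !) * x ≋ 1# / fromℕ (suc n !) * (fromℕ (suc n) * x)
  1/n!-expand n x = begin
    1# * p⁻¹ * x             ≈⟨ solve 2 (λ p x → con 1 :* p :* x := p :* con 1 :* x) refl p⁻¹ x ⟩
    p⁻¹ * 1# * x             ≈⟨ *-congʳ (*-congˡ (*-inverseʳ _ (fromℕ-!≉0 (suc n)))) ⟨
    p⁻¹ * (fromℕ (suc n !) * r) * x ≈⟨ *-congʳ (*-congˡ (*-congʳ (×1-homo-* (suc n) (n !)))) ⟩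
    p⁻¹ * (m * p * r) * x    ≈⟨ solve 5 (λ i m p r x → i :* (m :* p :* r) :* x := (p :* i) :* (con 1 :* r :* (m :* x))) refl p⁻¹ m p r x ⟩
    (p * p⁻¹) * (1# * r * (m * x)) ≈⟨ *-congʳ (*-inverseʳ p (fromℕ-!≉0 n)) ⟩
    1# * (1# * r * (m * x))  ≈⟨ *-identityˡ _ ⟩
    1# * r * (m * x)         ∎
    where
    open SetoidReasoning setoid
    m = fromℕ (suc n)
    p = fromℕ (n !)
    p⁻¹ = fromℕ (n !) ⁻¹
    r = fromℕ (suc n !) ⁻¹

  -- Finite sums and products.

  Σ-cong : ∀ {a} {A : Set a} (xs : List A) {f g : A → Carrier} →
    (∀ x → f x ≋ g x) → Σ[ xs ] f ≋ Σ[ xs ] g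
  Σ-cong []       f≋g = refl
  Σ-cong (x ∷ xs) f≋g = +-cong (f≋g x) (Σ-cong xs f≋g)

  Π-cong : ∀ {a} {A : Set a} (xs : List A) {f g : A → Carrier} →
    (∀ x → f x ≋ g x) → Π[ xs ] f ≋ Π[ xs ] g
  Π-cong []       f≋g = refl
  Π-cong (x ∷ xs) f≋g = *-cong (f≋g x) (Π-cong xs f≋g)

  Σ-0 : ∀ {a} {A : Set a} (xs : List A) → Σ[ xs ] (λ _ → 0#) ≋ 0#
  Σ-0 []       = refl
  Σ-0 (x ∷ xs) = trans (+-identityˡ _) (Σ-0 xs)

  Σ-+ : ∀ {a} {A : Set a} (xs : List A) (f g : A → Carrier) →
    Σ[ xs ] (λ x → f x + g x) ≋ Σ[ xs ] f + Σ[ xs ] g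
  Σ-+ []       f g = sym (+-identityˡ 0#)
  Σ-+ (x ∷ xs) f g = trans (+-congˡ (Σ-+ xs f g))
    (solve 4 (λ a b c d → (a :+ b) :+ (c :+ d) := (a :+ c) :+ (b :+ d)) refl _ _ _ _)

  Σ-*ˡ : ∀ {a} {A : Set a} (xs : List A) z (f : A → Carrier) →
    Σ[ xs ] (λ x → z * f x) ≋ z * Σ[ xs ] f
  Σ-*ˡ []       z f = sym (zeroʳ z)
  Σ-*ˡ (x ∷ xs) z f = trans (+-congˡ (Σ-*ˡ xs z f)) (sym (distribˡ z _ _))

  Σ-swap : ∀ {a b} {A : Set a} {B : Set b} (xs : List A) (ys : List B) (f : A → B → Carrier) →
    Σ[ xs ] (λ x → Σ[ ys ] (f x)) ≋ Σ[ ys ] (λ y → Σ[ xs ] (λ x → f x y))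
  Σ-swap []       ys f = sym (Σ-0 ys)
  Σ-swap (x ∷ xs) ys f = trans (+-congˡ (Σ-swap xs ys f)) (sym (Σ-+ ys _ _))

  Σ-++ : ∀ {a} {A : Set a} (xs ys : List A) (f : A → Carrier) →
    Σ[ xs ++ ys ] f ≋ Σ[ xs ] f + Σ[ ys ] f
  Σ-++ []       ys f = sym (+-identityˡ _)
  Σ-++ (x ∷ xs) ys f = trans (+-congˡ (Σ-++ xs ys f)) (sym (+-assoc _ _ _))

  Σ-map : ∀ {a b} {A : Set a} {B : Set b} (h : A → B) (xs : List A) (f : B → Carrier) →
    Σ[ map h xs ] f ≋ Σ[ xs ] (f ∘ h)
  Σ-map h []       f = refl
  Σ-map h (x ∷ xs) f = +-congˡ (Σ-map h xs f)

  Σ-concatMap : ∀ {a b} {A : Set a} {B : Set b} (h : A → List B) (xs : List A) (f : B → Carrier) →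
    Σ[ concatMap h xs ] f ≋ Σ[ xs ] (λ x → Σ[ h x ] f)
  Σ-concatMap h []       f = refl
  Σ-concatMap h (x ∷ xs) f =
    trans (Σ-++ (h x) (concatMap h xs) f) (+-congˡ (Σ-concatMap h xs f))

  Π-filter : ∀ {a p} {A : Set a} {P : A → Set p} (P? : Decidable P) (xs : List A) (f : A → Carrier) →
    Π[ filter P? xs ] f ≋ Π[ xs ] (λ x → if does (P? x) then f x else 1#)
  Π-filter P? []       f = refl
  Π-filter P? (x ∷ xs) f with does (P? x)
  ... | true  = *-congˡ (Π-filter P? xs f)
  ... | false = trans (Π-filter P? xs f) (sym (*-identityˡ _))

  Σ-allFin-suc : ∀ n (f : Fin (suc n) → Carrier) →
    Σ[ allFin (suc n) ] f ≡ f zero + Σ[ allFin n ] (f ∘ suc)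
  Σ-allFin-suc n f = ≡.cong (λ ys → f zero + foldr _+_ 0# ys)
    (≡.trans (map-tabulate suc f) (≡.sym (map-tabulate id (f ∘ suc))))

  Π-allFin-suc : ∀ n (f : Fin (suc n) → Carrier) →
    Π[ allFin (suc n) ] f ≡ f zero * Π[ allFin n ] (f ∘ suc)
  Π-allFin-suc n f = ≡.cong (λ ys → f zero * foldr _*_ 1# ys)
    (≡.trans (map-tabulate suc f) (≡.sym (map-tabulate id (f ∘ suc))))

  Σ-upTo-suc : ∀ n (f : ℕ → Carrier) →
    Σ[ upTo (suc n) ] f ≡ f 0 + Σ[ upTo n ] (f ∘ suc)
  Σ-upTo-suc n f = ≡.cong (λ ys → f 0 + foldr _+_ 0# ys)
    (≡.trans (map-applyUpTo suc f n) (≡.sym (map-upTo (f ∘ suc) n)))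

  Σ-upTo-last : ∀ n (f : ℕ → Carrier) →
    Σ[ upTo (suc n) ] f ≋ Σ[ upTo n ] f + f n
  Σ-upTo-last ℕ.zero  f = +-comm _ _
  Σ-upTo-last (suc n) f = begin
    Σ[ upTo (suc (suc n)) ] f                     ≡⟨ Σ-upTo-suc (suc n) f ⟩
    f 0 + Σ[ upTo (suc n) ] (f ∘ suc)             ≈⟨ +-congˡ (Σ-upTo-last n (f ∘ suc)) ⟩
    f 0 + (Σ[ upTo n ] (f ∘ suc) + f (suc n))     ≈⟨ +-assoc _ _ _ ⟨
    f 0 + Σ[ upTo n ] (f ∘ suc) + f (suc n)       ≡⟨ ≡.cong (_+ f (suc n)) (Σ-upTo-suc n f) ⟨
    Σ[ upTo (suc n) ] f + f (suc n)               ∎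
    where open SetoidReasoning setoid

  Σ-upTo-cong : ∀ n {f g : ℕ → Carrier} → (∀ {l} → l ℕ.< n → f l ≋ g l) →
    Σ[ upTo n ] f ≋ Σ[ upTo n ] g
  Σ-upTo-cong ℕ.zero              f≋g = refl
  Σ-upTo-cong (suc n) {f} {g} f≋g = begin
    Σ[ upTo (suc n) ] f            ≡⟨ Σ-upTo-suc n f ⟩
    f 0 + Σ[ upTo n ] (f ∘ suc)    ≈⟨ +-cong (f≋g (s≤s z≤n)) (Σ-upTo-cong n (λ l<n → f≋g (s≤s l<n))) ⟩
    g 0 + Σ[ upTo n ] (g ∘ suc)    ≡⟨ Σ-upTo-suc n g ⟨
    Σ[ upTo (suc n) ] g            ∎
    where open SetoidReasoning setoid

  Σ-allFin-toℕ : ∀ n (f : ℕ → Carrier) → Σ[ allFin n ] (f ∘ toℕ) ≋ Σ[ upTo n ] f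
  Σ-allFin-toℕ ℕ.zero  f = refl
  Σ-allFin-toℕ (suc n) f = begin
    Σ[ allFin (suc n) ] (f ∘ toℕ)            ≡⟨ Σ-allFin-suc n (f ∘ toℕ) ⟩
    f 0 + Σ[ allFin n ] (f ∘ suc ∘ toℕ)      ≈⟨ +-congˡ (Σ-allFin-toℕ n (f ∘ suc)) ⟩
    f 0 + Σ[ upTo n ] (f ∘ suc)              ≡⟨ Σ-upTo-suc n f ⟨
    Σ[ upTo (suc n) ] f                      ∎
    where open SetoidReasoning setoid

  Σ-allFin-const : ∀ n x → Σ[ allFin n ] (λ _ → x) ≋ fromℕ n * x
  Σ-allFin-const ℕ.zero  x = sym (zeroˡ x)
  Σ-allFin-const (suc n) x = begin
    Σ[ allFin (suc n) ] (λ _ → x)    ≡⟨ Σ-allFin-suc n (λ _ → x) ⟩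
    x + Σ[ allFin n ] (λ _ → x)      ≈⟨ +-congˡ (Σ-allFin-const n x) ⟩
    x + fromℕ n * x                  ≈⟨ solve 2 (λ n x → x :+ n :* x := (con 1 :+ n) :* x) refl _ _ ⟩
    fromℕ (suc n) * x                ∎
    where open SetoidReasoning setoid

  -- Exactly l of the n indices lie below the threshold, and `l ≤ n` makes the truncated difference
  -- `n ∸ l` the true number of the others.
  Σ-allFin-threshold : ∀ n {l} → l ℕ.≤ n → ∀ x y →
    Σ[ allFin n ] (λ m → if toℕ m <ᵇ l then x else y) ≋ fromℕ l * x + fromℕ (n ∸ l) * y
  Σ-allFin-threshold n z≤n x y = begin
    Σ[ allFin n ] (λ _ → y)    ≈⟨ Σ-allFin-const n y ⟩
    fromℕ n * y                ≈⟨ solve 2 (λ x z → z := con 0 :* x :+ z) refl x _ ⟩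
    0# * x + fromℕ n * y       ∎
    where open SetoidReasoning setoid
  Σ-allFin-threshold (suc n) {suc l} (s≤s l≤n) x y = begin
    Σ[ allFin (suc n) ] (λ m → if toℕ m <ᵇ suc l then x else y)
      ≡⟨ Σ-allFin-suc n (λ m → if toℕ m <ᵇ suc l then x else y) ⟩
    x + Σ[ allFin n ] (λ m → if toℕ m <ᵇ l then x else y)
      ≈⟨ +-congˡ (Σ-allFin-threshold n l≤n x y) ⟩
    x + (fromℕ l * x + fromℕ (n ∸ l) * y)
      ≈⟨ solve 3 (λ x l z → x :+ (l :* x :+ z) := (con 1 :+ l) :* x :+ z) refl x _ _ ⟩
    fromℕ (suc l) * x + fromℕ (n ∸ l) * y
      ∎
    where open SetoidReasoning setoid

  -- Order sums, built by inserting one element at a time.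

  -- An order with i elements before and j after the marked one has i + 1 places before it for a new
  -- element, which then contributes its factor u, and j + 1 places after it, where it contributes
  -- nothing.
  step : Carrier → (ℕ → ℕ → Carrier) → ℕ → ℕ → Carrier
  step u f i j = fromℕ (suc i) * (u * f (suc i) j) + fromℕ (suc j) * f i (suc j)

  -- orderSum u f is the sum over S ⊆ {1,…,n} of |S|! (n − |S|)! f(|S|, n − |S|) ∏_{i∈S} uᵢ;
  -- f i j weighs the configurations with i elements before and j elements after a marked one.
  orderSum : ∀ {n} → Vector Carrier n → (ℕ → ℕ → Carrier) → Carrier
  orderSum {ℕ.zero} u f = f 0 0
  orderSum {suc n}  u f = orderSum (tail u) (step (head u) f)

  step-cong : ∀ {u v} {f g : ℕ → ℕ → Carrier} {n} → u ≋ v →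
    (∀ i j → i ℕ.+ j ≡ suc n → f i j ≋ g i j) →
    ∀ i j → i ℕ.+ j ≡ n → step u f i j ≋ step v g i j
  step-cong u≋v f≋g i j i+j≡n = +-cong
    (*-congˡ (*-cong u≋v (f≋g (suc i) j (≡.cong suc i+j≡n))))
    (*-congˡ (f≋g i (suc j) (≡.trans (+-suc i j) (≡.cong suc i+j≡n))))

  -- An order sum of n entries reads its weight only where i + j = n. Agreement on this diagonal is
  -- what `orderSum-1∷` can supply, where the weight is constant along it.
  orderSum-cong : ∀ {n} {u v : Vector Carrier n} {f g : ℕ → ℕ → Carrier} →
    (∀ i → u i ≋ v i) → (∀ i j → i ℕ.+ j ≡ n → f i j ≋ g i j) → orderSum u f ≋ orderSum v g
  orderSum-cong {ℕ.zero} u≋v f≋g = f≋g 0 0 ≡.refl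
  orderSum-cong {suc n}  u≋v f≋g =
    orderSum-cong (u≋v ∘ suc) (step-cong (u≋v zero) f≋g)

  orderSum-replicate-cong : ∀ n {v q q′} (f : ℕ → ℕ → Carrier) → q ≋ q′ →
    orderSum (v ∷ᵛ replicate n q) f ≋ orderSum (v ∷ᵛ replicate n q′) f
  orderSum-replicate-cong n {v} {q} {q′} f q≋q′ =
    orderSum-cong {u = replicate n q} {v = replicate n q′} {f = step v f} (λ _ → q≋q′) (λ _ _ _ → refl)

  step-mono : ∀ {u} {f g : ℕ → ℕ → Carrier} → 0# ≤ u → (∀ i j → f i j ≤ g i j) →
    ∀ i j → step u f i j ≤ step u g i j
  step-mono 0≤u f≤g i j = +-mono-≤
    (*-monoʳ-≤ (fromℕ-nonNeg (suc i)) (*-monoʳ-≤ 0≤u (f≤g (suc i) j)))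
    (*-monoʳ-≤ (fromℕ-nonNeg (suc j)) (f≤g i (suc j)))

  step-nonNeg : ∀ {u} {f : ℕ → ℕ → Carrier} → 0# ≤ u → (∀ i j → 0# ≤ f i j) →
    ∀ i j → 0# ≤ step u f i j
  step-nonNeg 0≤u 0≤f i j = +-nonNeg
    (*-nonNeg (fromℕ-nonNeg (suc i)) (*-nonNeg 0≤u (0≤f (suc i) j)))
    (*-nonNeg (fromℕ-nonNeg (suc j)) (0≤f i (suc j)))

  orderSum-mono : ∀ {n} {u : Vector Carrier n} {f g : ℕ → ℕ → Carrier} →
    (∀ i → 0# ≤ u i) → (∀ i j → f i j ≤ g i j) → orderSum u f ≤ orderSum u g
  orderSum-mono {ℕ.zero} 0≤u f≤g = f≤g 0 0
  orderSum-mono {suc n}  0≤u f≤g = orderSum-mono (0≤u ∘ suc) (step-mono (0≤u zero) f≤g)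

  step-* : ∀ z u (f : ℕ → ℕ → Carrier) i j →
    step u (λ i j → z * f i j) i j ≋ z * step u f i j
  step-* z u f i j = solve 6
    (λ z u a x b y → a :* (u :* (z :* x)) :+ b :* (z :* y) := z :* (a :* (u :* x) :+ b :* y))
    refl z u _ _ _ _

  orderSum-* : ∀ {n} z (u : Vector Carrier n) (f : ℕ → ℕ → Carrier) →
    orderSum u (λ i j → z * f i j) ≋ z * orderSum u f
  orderSum-* {ℕ.zero} z u f = refl
  orderSum-* {suc n}  z u f = trans
    (orderSum-cong {u = tail u} (λ _ → refl) (λ i j _ → step-* z (head u) f i j))
    (orderSum-* z (tail u) (step (head u) f))

  -- Two insertions depend on u and v only through u * v and u + v. Both the symmetry and the
  -- smoothing of order sums are read off from this form.
  step-step : ∀ u v (f : ℕ → ℕ → Carrier) i j → step v (step u f) i j ≋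
    fromℕ (suc i) * fromℕ (suc (suc i)) * f (suc (suc i)) j * (u * v)
    + fromℕ (suc i) * fromℕ (suc j) * f (suc i) (suc j) * (u + v)
    + fromℕ (suc j) * fromℕ (suc (suc j)) * f i (suc (suc j))
  step-step u v f i j = solve 9
    (λ u v a b c d x y z →
      a :* (v :* (b :* (u :* x) :+ c :* y)) :+ c :* (a :* (u :* y) :+ d :* z)
      := a :* b :* x :* (u :* v) :+ a :* c :* y :* (u :+ v) :+ c :* d :* z)
    refl u v (fromℕ (suc i)) (fromℕ (suc (suc i))) (fromℕ (suc j)) (fromℕ (suc (suc j))) _ _ _

  step-comm : ∀ u v (f : ℕ → ℕ → Carrier) i j → step v (step u f) i j ≋ step u (step v f) i j
  step-comm u v f i j = trans (step-step u v f i j) (trans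
    (+-congʳ (+-cong (*-congˡ (*-comm u v)) (*-congˡ (+-comm u v))))
    (sym (step-step v u f i j)))

  -- Smoothing of the entries of an order sum.

  -- With the sum u + v fixed, only the term in u * v changes. Its coefficient is nonnegative and
  -- the product grows by e.
  step-smooth : ∀ {u v u′ v′ e} {f : ℕ → ℕ → Carrier} → u + v ≋ u′ + v′ → u′ * v′ ≋ u * v + e →
    0# ≤ e → (∀ i j → 0# ≤ f i j) → ∀ i j → step v (step u f) i j ≤ step v′ (step u′ f) i j
  step-smooth {u} {v} {u′} {v′} {e} {f} sum≋ product≋ 0≤e 0≤f i j = begin
    step v (step u f) i j                      ≈⟨ step-step u v f i j ⟩
    p * (u * v) + q * (u + v) + r              ≤⟨ x≤x+e (*-nonNeg (*-nonNeg (*-nonNeg (fromℕ-nonNeg (suc i)) (fromℕ-nonNeg (suc (suc i)))) (0≤f (suc (suc i)) j)) 0≤e) ⟩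
    p * (u * v) + q * (u + v) + r + p * e      ≈⟨ solve 5 (λ p x y r e → p :* x :+ y :+ r :+ p :* e := p :* (x :+ e) :+ y :+ r) refl p _ _ r e ⟩
    p * (u * v + e) + q * (u + v) + r          ≈⟨ +-congʳ (+-cong (*-congˡ (sym product≋)) (*-congˡ sum≋)) ⟩
    p * (u′ * v′) + q * (u′ + v′) + r          ≈⟨ step-step u′ v′ f i j ⟨
    step v′ (step u′ f) i j                    ∎
    where
    open POReasoning poset
    p = fromℕ (suc i) * fromℕ (suc (suc i)) * f (suc (suc i)) j
    q = fromℕ (suc i) * fromℕ (suc j) * f (suc i) (suc j)
    r = fromℕ (suc j) * fromℕ (suc (suc j)) * f i (suc (suc j))

  -- The entries on both sides have the same sum; one copy of q at a time is raised to the
  -- average q + δ at the expense of the first entry.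
  orderSum-smooth : ∀ n {q δ} {f : ℕ → ℕ → Carrier} → 0# ≤ q → 0# ≤ δ → (∀ i j → 0# ≤ f i j) →
    orderSum (((q + δ) + fromℕ n * δ) ∷ᵛ replicate n q) f ≤ orderSum (replicate (suc n) (q + δ)) f
  orderSum-smooth ℕ.zero {q} {δ} {f} 0≤q 0≤δ 0≤f = ≤-reflexive
    (step-cong {f = f} (solve 2 (λ x y → x :+ con 0 :* y := x) refl (q + δ) δ)
      (λ _ _ _ → refl) 0 0 ≡.refl)
  orderSum-smooth (suc n) {q} {δ} {f} 0≤q 0≤δ 0≤f = begin
    orderSum (replicate n q) (step q (step ((q + δ) + fromℕ (suc n) * δ) f))
      -- Passing δ from the large entry to one copy of q keeps the sum and raises the product by (n
      -- + 1) δ². The raised copy is inserted first, so it becomes part of the weight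
      -- `step (q + δ) f` in the induction.
      ≤⟨ orderSum-mono {u = replicate n q} (λ _ → 0≤q) (step-smooth
           (solve 3 (λ q δ N → (q :+ δ :+ (con 1 :+ N) :* δ) :+ q := (q :+ δ) :+ (q :+ δ :+ N :* δ)) refl q δ (fromℕ n))
           (solve 3 (λ q δ N → (q :+ δ) :* (q :+ δ :+ N :* δ) := (q :+ δ :+ (con 1 :+ N) :* δ) :* q :+ (con 1 :+ N) :* (δ :* δ)) refl q δ (fromℕ n))
           (*-nonNeg (fromℕ-nonNeg (suc n)) (*-nonNeg 0≤δ 0≤δ)) 0≤f) ⟩
    orderSum (replicate n q) (step ((q + δ) + fromℕ n * δ) (step (q + δ) f))
      ≤⟨ orderSum-smooth n 0≤q 0≤δ (step-nonNeg (+-nonNeg 0≤q 0≤δ) 0≤f) ⟩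
    orderSum (replicate (suc n) (q + δ)) (step (q + δ) f)
      ∎
    where open POReasoning poset

  𝟙 : ℕ → ℕ → Carrier
  𝟙 _ _ = 1#

  -- A factor 1 leaves every product unchanged, and the new element can take any of n + 2 places in
  -- an order of n elements and the marked one.
  orderSum-1∷ : ∀ {n} (u : Vector Carrier n) →
    orderSum (1# ∷ᵛ u) 𝟙 ≋ fromℕ (2 ℕ.+ n) * orderSum u 𝟙
  orderSum-1∷ {n} u = trans
    (orderSum-cong {v = u} (λ _ → refl) λ i j i+j≡n → begin
      fromℕ (suc i) * (1# * 1#) + fromℕ (suc j) * 1#
        ≈⟨ solve 2 (λ i j → (con 1 :+ i) :* (con 1 :* con 1) :+ (con 1 :+ j) :* con 1 := (con 1 :+ (con 1 :+ (i :+ j))) :* con 1) refl (fromℕ i) (fromℕ j) ⟩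
      (1# + (1# + (fromℕ i + fromℕ j))) * 1#
        ≈⟨ *-congʳ (+-congˡ (+-congˡ (fromℕ-+ i j))) ⟨
      fromℕ (2 ℕ.+ (i ℕ.+ j)) * 1#
        ≡⟨ ≡.cong (λ m → fromℕ (2 ℕ.+ m) * 1#) i+j≡n ⟩
      fromℕ (2 ℕ.+ n) * 1# ∎)
    (orderSum-* (fromℕ (2 ℕ.+ n)) u 𝟙)
    where open SetoidReasoning setoid

  -- The factor n + 3 is absorbed as an additional entry 1. By `average` this entry equals (q + δ) +
  -- n δ, so together with the n copies of q it can be smoothed to n + 1 copies of q + δ.
  orderSum-average : ∀ n {v q δ} → 0# ≤ v → 0# ≤ q → 0# ≤ δ → (q + δ) + fromℕ n * δ ≋ 1# →
    fromℕ (3 ℕ.+ n) * orderSum (v ∷ᵛ replicate n q) 𝟙 ≤ orderSum (v ∷ᵛ replicate (suc n) (q + δ)) 𝟙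
  orderSum-average n {v} {q} {δ} 0≤v 0≤q 0≤δ average = begin
    fromℕ (3 ℕ.+ n) * orderSum (v ∷ᵛ replicate n q) 𝟙
      ≈⟨ orderSum-1∷ (v ∷ᵛ replicate n q) ⟨
    orderSum (replicate n q) (step v (step 1# 𝟙))
      -- Once v is inserted first it belongs to the weight `step v 𝟙`, and smoothing leaves it
      -- alone.
      ≈⟨ orderSum-cong {u = replicate n q} (λ _ → refl) (λ i j _ → step-comm 1# v 𝟙 i j) ⟩
    orderSum (replicate n q) (step 1# (step v 𝟙))
      ≈⟨ orderSum-cong {u = replicate n q} (λ _ → refl) (step-cong {f = step v 𝟙} (sym average) (λ _ _ _ → refl)) ⟩
    orderSum (replicate n q) (step ((q + δ) + fromℕ n * δ) (step v 𝟙))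
      ≤⟨ orderSum-smooth n 0≤q 0≤δ (step-nonNeg 0≤v (λ _ _ → 0≤1)) ⟩
    orderSum (v ∷ᵛ replicate (suc n) (q + δ)) 𝟙
      ∎
    where open POReasoning poset

  -- Sums over permutations as order sums.

  -- The cutoff is a free number rather than the position of a marked element, so that removing an
  -- element from the permutation leaves a product of the same kind.
  prefixProduct : ∀ {k} → Vector Carrier k → Permutation′ k → ℕ → Carrier
  prefixProduct {k} u π l = Π[ allFin k ] λ i → if toℕ (π ⟨$⟩ʳ i) <ᵇ l then u i else 1#

  prefixProduct-insert : ∀ {k} (u : Vector Carrier (suc k)) (m : Fin (suc k)) (π : Permutation′ k) l →
    prefixProduct u (insert zero m π) l ≋
    (if toℕ m <ᵇ l then head u * prefixProduct (tail u) π (pred l) else prefixProduct (tail u) π l)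
  prefixProduct-insert {k} u m π l = trans
    (reflexive (Π-allFin-suc k (λ i → if toℕ (insert zero m π ⟨$⟩ʳ i) <ᵇ l then u i else 1#)))
    (trans (*-congˡ (Π-cong (allFin k) λ i → reflexive (≡.cong (λ b → if b then tail u i else 1#)
      (≡.trans (≡.cong (λ j → toℕ j <ᵇ l) (insert-punchIn zero m π i)) (punchIn-<ᵇ m (π ⟨$⟩ʳ i) l)))))
    split)
    where
    split : (if toℕ m <ᵇ l then u zero else 1#) *
      (Π[ allFin k ] λ i → if (if toℕ m <ᵇ l then toℕ (π ⟨$⟩ʳ i) <ᵇ pred l else toℕ (π ⟨$⟩ʳ i) <ᵇ l) then tail u i else 1#)
      ≋ (if toℕ m <ᵇ l then head u * prefixProduct (tail u) π (pred l) else prefixProduct (tail u) π l)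
    split with toℕ m <ᵇ l
    ... | true  = refl
    ... | false = *-identityˡ _

  -- With the place of `zero` in the inner sum, its possible places can be counted for a fixed order
  -- of the other elements.
  Σ-permutations-suc : ∀ k (g : Permutation′ (suc k) → Carrier) →
    Σ[ permutations (suc k) ] g ≋
    Σ[ permutations k ] (λ π → Σ[ allFin (suc k) ] (λ m → g (insert zero m π)))
  Σ-permutations-suc k g = begin
    Σ[ permutations (suc k) ] g
      ≈⟨ Σ-concatMap (λ m → map (insert zero m) (permutations k)) (allFin (suc k)) g ⟩
    Σ[ allFin (suc k) ] (λ m → Σ[ map (insert zero m) (permutations k) ] g)
      ≈⟨ Σ-cong (allFin (suc k)) (λ m → Σ-map (insert zero m) (permutations k) g) ⟩
    Σ[ allFin (suc k) ] (λ m → Σ[ permutations k ] (λ π → g (insert zero m π)))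
      ≈⟨ Σ-swap (allFin (suc k)) (permutations k) (λ m π → g (insert zero m π)) ⟩
    Σ[ permutations k ] (λ π → Σ[ allFin (suc k) ] (λ m → g (insert zero m π)))
      ∎
    where open SetoidReasoning setoid

  -- For a fixed cutoff l, the first element falls below it for l of its places, contributing
  -- `head u`, and above it for the other k + 1 - l. Collecting the terms by the number of remaining
  -- elements below the cutoff yields `step`.
  Σ-insert-prefixProduct : ∀ {k} (u : Vector Carrier (suc k)) (f : ℕ → ℕ → Carrier) (π : Permutation′ k) →
    Σ[ allFin (suc k) ] (λ m → Σ[ upTo (2 ℕ.+ k) ] λ l →
      f l (suc k ∸ l) * prefixProduct u (insert zero m π) l) ≋
    Σ[ upTo (suc k) ] (λ l → step (head u) f l (k ∸ l) * prefixProduct (tail u) π l)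
  Σ-insert-prefixProduct {k} u f π = begin
    Σ[ allFin (suc k) ] (λ m → Σ[ upTo (2 ℕ.+ k) ] λ l →
      f l (suc k ∸ l) * prefixProduct u (insert zero m π) l)
      ≈⟨ Σ-swap (allFin (suc k)) (upTo (2 ℕ.+ k)) _ ⟩
    Σ[ upTo (2 ℕ.+ k) ] (λ l → Σ[ allFin (suc k) ] λ m →
      f l (suc k ∸ l) * prefixProduct u (insert zero m π) l)
      ≈⟨ Σ-upTo-cong (2 ℕ.+ k) countThresholds ⟩
    Σ[ upTo (2 ℕ.+ k) ] (λ l → fromℕ l * a l + fromℕ (suc k ∸ l) * b l)
      ≈⟨ Σ-+ (upTo (2 ℕ.+ k)) _ _ ⟩
    Σ[ upTo (2 ℕ.+ k) ] (λ l → fromℕ l * a l) + Σ[ upTo (2 ℕ.+ k) ] (λ l → fromℕ (suc k ∸ l) * b l)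
      -- The term l = 0 of the first sum and the term l = k + 1 of the second have coefficient 0;
      -- the first sum is then shifted by one.
      ≈⟨ +-cong dropFirst dropLast ⟩
    Σ[ upTo (suc k) ] (λ l → fromℕ (suc l) * a (suc l)) + Σ[ upTo (suc k) ] (λ l → fromℕ (suc k ∸ l) * b l)
      ≈⟨ Σ-+ (upTo (suc k)) _ _ ⟨
    Σ[ upTo (suc k) ] (λ l → fromℕ (suc l) * a (suc l) + fromℕ (suc k ∸ l) * b l)
      ≈⟨ Σ-upTo-cong (suc k) combine ⟩
    Σ[ upTo (suc k) ] (λ l → step (head u) f l (k ∸ l) * prefixProduct (tail u) π l)
      ∎
    where
    open SetoidReasoning setoid
    a b : ℕ → Carrier
    a l = f l (suc k ∸ l) * (head u * prefixProduct (tail u) π (pred l))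
    b l = f l (suc k ∸ l) * prefixProduct (tail u) π l

    *-if : ∀ t z x y → z * (if t then x else y) ≋ (if t then z * x else z * y)
    *-if true  z x y = refl
    *-if false z x y = refl

    countThresholds : ∀ {l} → l ℕ.< 2 ℕ.+ k →
      Σ[ allFin (suc k) ] (λ m → f l (suc k ∸ l) * prefixProduct u (insert zero m π) l) ≋
      fromℕ l * a l + fromℕ (suc k ∸ l) * b l
    countThresholds {l} (s≤s l≤1+k) = trans
      (Σ-cong (allFin (suc k)) λ m → trans (*-congˡ (prefixProduct-insert u m π l))
        (*-if (toℕ m <ᵇ l) (f l (suc k ∸ l)) _ _))
      (Σ-allFin-threshold (suc k) l≤1+k (a l) (b l))

    dropFirst : Σ[ upTo (2 ℕ.+ k) ] (λ l → fromℕ l * a l) ≋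
                Σ[ upTo (suc k) ] (λ l → fromℕ (suc l) * a (suc l))
    dropFirst = trans (reflexive (Σ-upTo-suc (suc k) (λ l → fromℕ l * a l)))
      (trans (+-congʳ (zeroˡ (a 0))) (+-identityˡ _))

    dropLast : Σ[ upTo (2 ℕ.+ k) ] (λ l → fromℕ (suc k ∸ l) * b l) ≋
               Σ[ upTo (suc k) ] (λ l → fromℕ (suc k ∸ l) * b l)
    dropLast = trans (Σ-upTo-last (suc k) (λ l → fromℕ (suc k ∸ l) * b l))
      (trans (+-congˡ (trans (*-congʳ (reflexive (≡.cong fromℕ (n∸n≡0 k)))) (zeroˡ _))) (+-identityʳ _))

    combine : ∀ {l} → l ℕ.< suc k →
      fromℕ (suc l) * a (suc l) + fromℕ (suc k ∸ l) * b l ≋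
      step (head u) f l (k ∸ l) * prefixProduct (tail u) π l
    -- Because l ≤ k, the truncated `suc k ∸ l` is `suc (k ∸ l)`, the coefficient in `step`.
    combine {l} (s≤s l≤k) rewrite suc-∸ l≤k = solve 6
      (λ A x v P B y → A :* (x :* (v :* P)) :+ B :* (y :* P) := (A :* (v :* x) :+ B :* y) :* P)
      refl (fromℕ (suc l)) (f (suc l) (k ∸ l)) (head u) (prefixProduct (tail u) π l)
      (fromℕ (suc (k ∸ l))) (f l (suc (k ∸ l)))

  -- A permutation together with a cutoff l is an order of the k elements and a marked one that has
  -- l of them before it. The induction removes the first element.
  Σ-prefixProduct : ∀ {k} (u : Vector Carrier k) (f : ℕ → ℕ → Carrier) →
    Σ[ permutations k ] (λ π → Σ[ upTo (suc k) ] λ l → f l (k ∸ l) * prefixProduct u π l) ≋ orderSum u f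
  Σ-prefixProduct {ℕ.zero} u f = solve 1 (λ x → (x :* con 1 :+ con 0) :+ con 0 := x) refl (f 0 0)
  Σ-prefixProduct {suc k}  u f = begin
    Σ[ permutations (suc k) ] (λ π → Σ[ upTo (2 ℕ.+ k) ] λ l → f l (suc k ∸ l) * prefixProduct u π l)
      ≈⟨ Σ-permutations-suc k _ ⟩
    Σ[ permutations k ] (λ π → Σ[ allFin (suc k) ] λ m → Σ[ upTo (2 ℕ.+ k) ] λ l →
      f l (suc k ∸ l) * prefixProduct u (insert zero m π) l)
      ≈⟨ Σ-cong (permutations k) (Σ-insert-prefixProduct u f) ⟩
    Σ[ permutations k ] (λ π → Σ[ upTo (suc k) ] λ l →
      step (head u) f l (k ∸ l) * prefixProduct (tail u) π l)
      ≈⟨ Σ-prefixProduct (tail u) (step (head u) f) ⟩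
    orderSum u f
      ∎
    where open SetoidReasoning setoid

  -- The marked element does not precede itself, so its own factor drops out.
  prefixProduct-insert-self : ∀ {k} (u : Vector Carrier (suc k)) (m : Fin (suc k)) (π : Permutation′ k) →
    prefixProduct u (insert zero m π) (toℕ m) ≋ prefixProduct (tail u) π (toℕ m)
  prefixProduct-insert-self u m π = trans (prefixProduct-insert u m π (toℕ m))
    (reflexive (≡.cong (λ b → if b then head u * prefixProduct (tail u) π (pred (toℕ m))
                                   else prefixProduct (tail u) π (toℕ m)) (<ᵇ-irrefl (toℕ m))))

  prefixProduct-insert-punchIn : ∀ {k} (u : Vector Carrier (suc k)) m (π : Permutation′ k) p →
    prefixProduct u (insert zero m π) (toℕ (punchIn m p)) ≋
    (if toℕ m <ᵇ suc (toℕ p) then head u * prefixProduct (tail u) π (toℕ p) else prefixProduct (tail u) π (toℕ p))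
  prefixProduct-insert-punchIn u m π p = trans (prefixProduct-insert u m π (toℕ (punchIn m p))) (reflexive eq)
    where
    eq : (if toℕ m <ᵇ toℕ (punchIn m p)
          then head u * prefixProduct (tail u) π (pred (toℕ (punchIn m p)))
          else prefixProduct (tail u) π (toℕ (punchIn m p)))
       ≡ (if toℕ m <ᵇ suc (toℕ p) then head u * prefixProduct (tail u) π (toℕ p) else prefixProduct (tail u) π (toℕ p))
    eq rewrite self-<ᵇ-punchIn m p | toℕ-punchIn m p with toℕ m <ᵇ suc (toℕ p)
    ... | true  = ≡.refl
    ... | false = ≡.refl

  -- The place of the marked element `zero` acts as a cutoff for the order of the other elements,
  -- each cutoff having weight 1.
  Σ-prefixProduct-zero : ∀ {k} (u : Vector Carrier (suc k)) →
    Σ[ permutations (suc k) ] (λ σ → prefixProduct u σ (toℕ (σ ⟨$⟩ʳ zero))) ≋ orderSum (tail u) 𝟙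
  Σ-prefixProduct-zero {k} u = begin
    Σ[ permutations (suc k) ] (λ σ → prefixProduct u σ (toℕ (σ ⟨$⟩ʳ zero)))
      ≈⟨ Σ-permutations-suc k _ ⟩
    Σ[ permutations k ] (λ π → Σ[ allFin (suc k) ] λ m → prefixProduct u (insert zero m π) (toℕ m))
      ≈⟨ Σ-cong (permutations k) (λ π → Σ-cong (allFin (suc k)) λ m →
           trans (prefixProduct-insert-self u m π) (sym (*-identityˡ _))) ⟩
    Σ[ permutations k ] (λ π → Σ[ allFin (suc k) ] λ m → 1# * prefixProduct (tail u) π (toℕ m))
      ≈⟨ Σ-cong (permutations k) (λ π → Σ-allFin-toℕ (suc k) (λ l → 1# * prefixProduct (tail u) π l)) ⟩
    Σ[ permutations k ] (λ π → Σ[ upTo (suc k) ] λ l → 1# * prefixProduct (tail u) π l)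
      ≈⟨ Σ-prefixProduct (tail u) 𝟙 ⟩
    orderSum (tail u) 𝟙
      ∎
    where open SetoidReasoning setoid

  -- Element `zero` is removed first: if the marked element then has place p, there are p + 1 places
  -- before it and k + 1 - p after it, which gives the weight `step (head u) 𝟙`. The marked element
  -- has now become the first one, and its place is again the cutoff.
  Σ-prefixProduct-one : ∀ {k} (u : Vector Carrier (2 ℕ.+ k)) →
    Σ[ permutations (2 ℕ.+ k) ] (λ σ → prefixProduct u σ (toℕ (σ ⟨$⟩ʳ suc zero))) ≋
    orderSum (head u ∷ᵛ tail (tail u)) 𝟙
  Σ-prefixProduct-one {k} u = begin
    Σ[ permutations (2 ℕ.+ k) ] (λ σ → prefixProduct u σ (toℕ (σ ⟨$⟩ʳ suc zero)))
      ≈⟨ Σ-permutations-suc (suc k) _ ⟩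
    Σ[ permutations (suc k) ] (λ π → Σ[ allFin (2 ℕ.+ k) ] λ m →
      prefixProduct u (insert zero m π) (toℕ (insert zero m π ⟨$⟩ʳ suc zero)))
      ≈⟨ Σ-cong (permutations (suc k)) countImages ⟩
    Σ[ permutations (suc k) ] (λ π → weight (toℕ (π ⟨$⟩ʳ zero)) * prefixProduct (tail u) π (toℕ (π ⟨$⟩ʳ zero)))
      ≈⟨ Σ-permutations-suc k _ ⟩
    Σ[ permutations k ] (λ ρ → Σ[ allFin (suc k) ] λ l →
      weight (toℕ l) * prefixProduct (tail u) (insert zero l ρ) (toℕ l))
      ≈⟨ Σ-cong (permutations k) (λ ρ → Σ-cong (allFin (suc k)) λ l →
           *-congˡ {weight (toℕ l)} (prefixProduct-insert-self (tail u) l ρ)) ⟩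
    Σ[ permutations k ] (λ ρ → Σ[ allFin (suc k) ] λ l → weight (toℕ l) * prefixProduct (tail (tail u)) ρ (toℕ l))
      ≈⟨ Σ-cong (permutations k) (λ ρ → Σ-allFin-toℕ (suc k) (λ l → weight l * prefixProduct (tail (tail u)) ρ l)) ⟩
    Σ[ permutations k ] (λ ρ → Σ[ upTo (suc k) ] λ l → weight l * prefixProduct (tail (tail u)) ρ l)
      ≈⟨ Σ-prefixProduct (tail (tail u)) (step (head u) 𝟙) ⟩
    orderSum (head u ∷ᵛ tail (tail u)) 𝟙
      ∎
    where
    open SetoidReasoning setoid
    weight : ℕ → Carrier
    weight l = step (head u) 𝟙 l (k ∸ l)

    countImages : ∀ π → Σ[ allFin (2 ℕ.+ k) ] (λ m →
      prefixProduct u (insert zero m π) (toℕ (insert zero m π ⟨$⟩ʳ suc zero))) ≋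
      weight (toℕ (π ⟨$⟩ʳ zero)) * prefixProduct (tail u) π (toℕ (π ⟨$⟩ʳ zero))
    countImages π = begin
      Σ[ allFin (2 ℕ.+ k) ] (λ m → prefixProduct u (insert zero m π) (toℕ (insert zero m π ⟨$⟩ʳ suc zero)))
        ≈⟨ Σ-cong (allFin (2 ℕ.+ k)) (λ m → trans
             (reflexive (≡.cong (λ i → prefixProduct u (insert zero m π) (toℕ i)) (insert-punchIn zero m π zero)))
             (prefixProduct-insert-punchIn u m π (π ⟨$⟩ʳ zero))) ⟩
      Σ[ allFin (2 ℕ.+ k) ] (λ m → if toℕ m <ᵇ suc p then head u * X else X)
        ≈⟨ Σ-allFin-threshold (2 ℕ.+ k) (s≤s (m≤n⇒m≤1+n p≤k)) (head u * X) X ⟩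
      fromℕ (suc p) * (head u * X) + fromℕ (suc k ∸ p) * X
        ≡⟨ ≡.cong (λ j → fromℕ (suc p) * (head u * X) + fromℕ j * X) (suc-∸ p≤k) ⟩
      fromℕ (suc p) * (head u * X) + fromℕ (suc (k ∸ p)) * X
        ≈⟨ solve 4 (λ a v b x → a :* (v :* x) :+ b :* x := (a :* (v :* con 1) :+ b :* con 1) :* x) refl _ (head u) _ X ⟩
      weight p * X
        ∎
      where
      p = toℕ (π ⟨$⟩ʳ zero)
      p≤k : p ℕ.≤ k
      p≤k = toℕ≤pred[n] (π ⟨$⟩ʳ zero)
      X = prefixProduct (tail u) π p

  -- Each summand of d marks x₁ or x₂; the marked entry leaves the order sum and the other one stays
  -- in it.
  d-orderSum : ∀ {n} (x : Vector Carrier (2 ℕ.+ n)) → let u = λ i → 1# - F K (x i) in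
    d K x ≋ 1# / fromℕ ((2 ℕ.+ n) !) *
      (F′ K (x zero) * orderSum (tail u) 𝟙 + F′ K (x (suc zero)) * orderSum (head u ∷ᵛ tail (tail u)) 𝟙)
  d-orderSum {n} x = *-congˡ (begin
    Σ[ perms ] (λ σ → a * before K x σ zero + b * before K x σ (suc zero))
      -- The Boolean of `_<?_` on `Fin` computes to the test `_<ᵇ_` used in `prefixProduct`.
      ≈⟨ Σ-cong perms (λ σ → +-cong (*-congˡ (Π-filter _ (allFin (2 ℕ.+ n)) u)) (*-congˡ (Π-filter _ (allFin (2 ℕ.+ n)) u))) ⟩
    Σ[ perms ] (λ σ → a * prefixProduct u σ (toℕ (σ ⟨$⟩ʳ zero)) + b * prefixProduct u σ (toℕ (σ ⟨$⟩ʳ suc zero)))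
      ≈⟨ Σ-+ perms _ _ ⟩
    Σ[ perms ] (λ σ → a * prefixProduct u σ (toℕ (σ ⟨$⟩ʳ zero))) + Σ[ perms ] (λ σ → b * prefixProduct u σ (toℕ (σ ⟨$⟩ʳ suc zero)))
      ≈⟨ +-cong (Σ-*ˡ perms a _) (Σ-*ˡ perms b _) ⟩
    a * Σ[ perms ] (λ σ → prefixProduct u σ (toℕ (σ ⟨$⟩ʳ zero))) + b * Σ[ perms ] (λ σ → prefixProduct u σ (toℕ (σ ⟨$⟩ʳ suc zero)))
      ≈⟨ +-cong (*-congˡ (Σ-prefixProduct-zero u)) (*-congˡ (Σ-prefixProduct-one u)) ⟩
    a * orderSum (tail u) 𝟙 + b * orderSum (head u ∷ᵛ tail (tail u)) 𝟙
      ∎)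
    where
    open SetoidReasoning setoid
    perms = permutations (2 ℕ.+ n)
    a = F′ K (x zero)
    b = F′ K (x (suc zero))
    u : Vector Carrier (2 ℕ.+ n)
    u i = 1# - F K (x i)

  -- The linear piece of F, whose slope is `κ`.

  κ : Carrier
  κ = fromℕ 11 / fromℕ 6

  0≤κ : 0# ≤ κ
  0≤κ = *-nonNeg (fromℕ-nonNeg 11) (fromℕ-suc⁻¹-nonNeg 5)

  κ≤2 : κ ≤ fromℕ 2
  κ≤2 = begin
    fromℕ 11 * fromℕ 6 ⁻¹              ≤⟨ *-monoˡ-≤ (fromℕ-suc⁻¹-nonNeg 5) (fromℕ-mono (m≤n⇒m≤1+n (≤-refl {11}))) ⟩
    fromℕ 12 * fromℕ 6 ⁻¹              ≈⟨ *-congʳ (×1-homo-* 2 6) ⟩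
    fromℕ 2 * fromℕ 6 * fromℕ 6 ⁻¹     ≈⟨ *-assoc _ _ _ ⟩
    fromℕ 2 * (fromℕ 6 * fromℕ 6 ⁻¹)   ≈⟨ *-congˡ (fromℕ-suc-inverseʳ 5) ⟩
    fromℕ 2 * 1#                       ≈⟨ *-identityʳ _ ⟩
    fromℕ 2                            ∎
    where open POReasoning poset

  F′-nonNeg : ∀ z → 0# ≤ F′ K z
  F′-nonNeg z with does (z ≤? fromℕ 6 / fromℕ 11)
  ... | true  = 0≤κ
  ... | false = ≤-reflᴷ

  1-F-nonNeg : ∀ z → 0# ≤ 1# - F K z
  1-F-nonNeg z = ≤⇒0≤- (MinOp.x⊓y≤y (NaturalMin.minOperator totalOrder) (κ * z) 1#)

  -- Since κ s ≤ κ ≤ 2, two or more equal shares of s lie on the linear piece of F. This is where k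
  -- ≥ 4 enters.
  κ*s/n≤1 : ∀ n {s} → s ≤ 1# → κ * (s / fromℕ (2 ℕ.+ n)) ≤ 1#
  κ*s/n≤1 n {s} s≤1 = begin
    κ * (s * N⁻¹)          ≈⟨ *-assoc _ _ _ ⟨
    κ * s * N⁻¹            ≤⟨ *-monoˡ-≤ (fromℕ-suc⁻¹-nonNeg (suc n)) (begin
      κ * s                  ≤⟨ *-monoʳ-≤ 0≤κ s≤1 ⟩
      κ * 1#                 ≈⟨ *-identityʳ κ ⟩
      κ                      ≤⟨ κ≤2 ⟩
      fromℕ 2                ≤⟨ fromℕ-mono (m≤m+n 2 n) ⟩
      fromℕ (2 ℕ.+ n)        ∎) ⟩
    fromℕ (2 ℕ.+ n) * N⁻¹  ≈⟨ fromℕ-suc-inverseʳ (suc n) ⟩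
    1#                     ∎
    where
    open POReasoning poset
    N⁻¹ = fromℕ (2 ℕ.+ n) ⁻¹

  F-linear : ∀ n {s} → s ≤ 1# → F K (s / fromℕ (2 ℕ.+ n)) ≋ κ * s * fromℕ (2 ℕ.+ n) ⁻¹
  F-linear n s≤1 = trans (NaturalMin.x≤y⇒x⊓y≈x totalOrder (κ*s/n≤1 n s≤1)) (sym (*-assoc _ _ _))

  -- The increment that turns q into the average.

  module _ (n : ℕ) (A : Carrier) where
    private
      N = fromℕ (suc n)
      p = fromℕ (suc n) ⁻¹
      r = fromℕ (2 ℕ.+ n) ⁻¹

    -- By partial fractions this is A/(n + 1) - A/(n + 2), the amount by which 1 - F at an equal
    -- share grows when one more share is added, for A = κ s on the linear piece.
    gap : Carrier
    gap = A * (p * r)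

    Ap≋Ar+gap : A * p ≋ A * r + gap
    Ap≋Ar+gap = begin
      A * p                          ≈⟨ *-identityʳ _ ⟨
      A * p * 1#                     ≈⟨ *-congˡ (fromℕ-suc-inverseʳ (suc n)) ⟨
      A * p * ((1# + N) * r)         ≈⟨ solve 4 (λ A p N r → A :* p :* ((con 1 :+ N) :* r) := A :* r :* (N :* p) :+ A :* (p :* r)) refl A p N r ⟩
      A * r * (N * p) + gap          ≈⟨ +-congʳ (*-congˡ (fromℕ-suc-inverseʳ n)) ⟩
      A * r * 1# + gap               ≈⟨ +-congʳ (*-identityʳ _) ⟩
      A * r + gap                    ∎
      where open SetoidReasoning setoid

    gap-step : (1# - A * p) + gap ≋ 1# - A * r
    gap-step = x+y≋z⇒x≋z-y (begin
      1# - A * p + gap + A * r       ≈⟨ solve 3 (λ x g y → x :+ g :+ y := x :+ (y :+ g)) refl _ gap (A * r) ⟩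
      1# - A * p + (A * r + gap)     ≈⟨ +-congˡ Ap≋Ar+gap ⟨
      1# - A * p + A * p             ≈⟨ +-assoc _ _ _ ⟩
      1# + (- (A * p) + A * p)       ≈⟨ +-congˡ (-‿inverseˡ _) ⟩
      1# + 0#                        ≈⟨ +-identityʳ 1# ⟩
      1#                             ∎)
      where open SetoidReasoning setoid

    -- Here N * gap is A/(n + 2), exactly what 1 - A/(n + 2) lacks to 1. This supplies the
    -- hypothesis `average` of `orderSum-average`.
    gap-average : ((1# - A * p) + gap) + N * gap ≋ 1#
    gap-average = begin
      ((1# - A * p) + gap) + N * gap  ≈⟨ +-cong gap-step (solve 4 (λ A p N r → N :* (A :* (p :* r)) := A :* r :* (N :* p)) refl A p N r) ⟩
      1# - A * r + A * r * (N * p)    ≈⟨ +-congˡ (*-congˡ (fromℕ-suc-inverseʳ n)) ⟩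
      1# - A * r + A * r * 1#         ≈⟨ +-congˡ (*-identityʳ _) ⟩
      1# - A * r + A * r              ≈⟨ +-assoc _ _ _ ⟩
      1# + (- (A * r) + A * r)        ≈⟨ +-congˡ (-‿inverseˡ _) ⟩
      1# + 0#                         ≈⟨ +-identityʳ 1# ⟩
      1#                              ∎
      where open SetoidReasoning setoid

    gap-nonNeg : 0# ≤ A → 0# ≤ gap
    gap-nonNeg 0≤A = *-nonNeg 0≤A (*-nonNeg (fromℕ-suc⁻¹-nonNeg n) (fromℕ-suc⁻¹-nonNeg (suc n)))

  -- Comparison of d for consecutive numbers of equal shares.

  orderSum-F-mono : ∀ n {v s} → 0# ≤ v → 0# ≤ s → s ≤ 1# →
    fromℕ (5 ℕ.+ n) * orderSum (v ∷ᵛ replicate (2 ℕ.+ n) (1# - F K (s / fromℕ (2 ℕ.+ n)))) 𝟙 ≤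
    orderSum (v ∷ᵛ replicate (3 ℕ.+ n) (1# - F K (s / fromℕ (3 ℕ.+ n)))) 𝟙
  orderSum-F-mono n {v} {s} 0≤v 0≤s s≤1 = begin
    fromℕ (5 ℕ.+ n) * orderSum (v ∷ᵛ replicate (2 ℕ.+ n) (1# - F K (s / fromℕ (2 ℕ.+ n)))) 𝟙
      ≈⟨ *-congˡ (orderSum-replicate-cong (2 ℕ.+ n) 𝟙 F≋) ⟩
    fromℕ (5 ℕ.+ n) * orderSum (v ∷ᵛ replicate (2 ℕ.+ n) q) 𝟙
      -- The gap lemmas count from one: their argument `suc n` stands for 2 + n copies of q.
      ≤⟨ orderSum-average (2 ℕ.+ n) 0≤v (≤-respʳ-≈ F≋ (1-F-nonNeg _))
           (gap-nonNeg (suc n) A (*-nonNeg 0≤κ 0≤s)) (gap-average (suc n) A) ⟩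
    orderSum (v ∷ᵛ replicate (3 ℕ.+ n) (q + gap (suc n) A)) 𝟙
      ≈⟨ orderSum-replicate-cong (3 ℕ.+ n) 𝟙
           (trans (gap-step (suc n) A) (+-congˡ (-‿cong (sym (F-linear (suc n) s≤1))))) ⟩
    orderSum (v ∷ᵛ replicate (3 ℕ.+ n) (1# - F K (s / fromℕ (3 ℕ.+ n)))) 𝟙
      ∎
    where
    open POReasoning poset
    A = κ * s
    q = 1# - A * fromℕ (2 ℕ.+ n) ⁻¹
    F≋ : 1# - F K (s / fromℕ (2 ℕ.+ n)) ≋ q
    F≋ = +-congˡ (-‿cong (F-linear n s≤1))

  -- Over the common denominator (n + 5)!, the smaller side carries a factor n + 5. Distributed over
  -- the two summands, it is the factor in `orderSum-F-mono`, used with v = 1 - F(x₂) and v = 1 -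
  -- F(x₁); the coefficients F′ are nonnegative.
  d-mono : ∀ n {x₁ x₂ s} → 0# ≤ s → s ≤ 1# →
    d K (x₁ ∷ᵛ x₂ ∷ᵛ replicate (2 ℕ.+ n) (s / fromℕ (2 ℕ.+ n))) ≤
    d K (x₁ ∷ᵛ x₂ ∷ᵛ replicate (3 ℕ.+ n) (s / fromℕ (3 ℕ.+ n)))
  d-mono n {x₁} {x₂} {s} 0≤s s≤1 = begin
    d K (x₁ ∷ᵛ x₂ ∷ᵛ replicate (2 ℕ.+ n) (s / fromℕ (2 ℕ.+ n)))
      ≈⟨ d-orderSum (x₁ ∷ᵛ x₂ ∷ᵛ replicate (2 ℕ.+ n) (s / fromℕ (2 ℕ.+ n))) ⟩
    1# / fromℕ ((4 ℕ.+ n) !) * (a * X + b * Y)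
      ≈⟨ 1/n!-expand (4 ℕ.+ n) _ ⟩
    1# / fromℕ ((5 ℕ.+ n) !) * (m * (a * X + b * Y))
      ≈⟨ *-congˡ (solve 5 (λ m a x b y → m :* (a :* x :+ b :* y) := a :* (m :* x) :+ b :* (m :* y)) refl m a X b Y) ⟩
    1# / fromℕ ((5 ℕ.+ n) !) * (a * (m * X) + b * (m * Y))
      ≤⟨ *-monoʳ-≤ (*-nonNeg 0≤1 (⁻¹-nonNeg (fromℕ-nonNeg ((5 ℕ.+ n) !)) (fromℕ-!≉0 (5 ℕ.+ n))))
           (+-mono-≤ (*-monoʳ-≤ (F′-nonNeg x₁) (orderSum-F-mono n (1-F-nonNeg x₂) 0≤s s≤1))
                     (*-monoʳ-≤ (F′-nonNeg x₂) (orderSum-F-mono n (1-F-nonNeg x₁) 0≤s s≤1))) ⟩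
    1# / fromℕ ((5 ℕ.+ n) !) * (a * X′ + b * Y′)
      ≈⟨ d-orderSum (x₁ ∷ᵛ x₂ ∷ᵛ replicate (3 ℕ.+ n) (s / fromℕ (3 ℕ.+ n))) ⟨
    d K (x₁ ∷ᵛ x₂ ∷ᵛ replicate (3 ℕ.+ n) (s / fromℕ (3 ℕ.+ n)))
      ∎
    where
    open POReasoning poset
    m = fromℕ (5 ℕ.+ n)
    a = F′ K x₁
    b = F′ K x₂
    value : ℕ → Carrier → Carrier
    value k x = orderSum ((1# - F K x) ∷ᵛ replicate k (1# - F K (s / fromℕ k))) 𝟙
    X  = value (2 ℕ.+ n) x₂
    Y  = value (2 ℕ.+ n) x₁
    X′ = value (3 ℕ.+ n) x₂
    Y′ = value (3 ℕ.+ n) x₁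

  -- The range of s = 1 - x₁ - x₂, and the conclusion.

  complement+ : ∀ x y → (1# - x - y) + (x + y) ≋ 1#
  complement+ x y = begin
    (1# - x - y) + (x + y)          ≈⟨ solve 4 (λ x y x′ y′ → con 1 :+ x′ :+ y′ :+ (x :+ y) := con 1 :+ (x :+ x′) :+ (y :+ y′)) refl x y (- x) (- y) ⟩
    1# + (x - x) + (y - y)          ≈⟨ +-cong (+-congˡ (-‿inverseʳ x)) (-‿inverseʳ y) ⟩
    1# + 0# + 0#                    ≈⟨ solve 0 (con 1 :+ con 0 :+ con 0 := con 1) refl ⟩
    1#                              ∎
    where open SetoidReasoning setoid

  complement-nonNeg : ∀ {x y} → x + y ≤ 1# → 0# ≤ 1# - x - y
  complement-nonNeg {x} {y} x+y≤1 = ≤-respʳ-≈ (sym (x+y≋z⇒x≋z-y (complement+ x y))) (≤⇒0≤- x+y≤1)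

  complement≤1 : ∀ {x y} → 0# ≤ x → 0# ≤ y → 1# - x - y ≤ 1#
  complement≤1 {x} {y} 0≤x 0≤y = ≤-respʳ-≈ (complement+ x y) (x≤x+e (+-nonNeg 0≤x 0≤y))

lemma6p5 : {c ℓ₁ ℓ₂ : Level} (R : Reals c ℓ₁ ℓ₂) → let open Reals R in
    (k : ℕ) (4≤k : 4 ℕ.≤ k) (x₁ x₂ : Carrier) →
    0# ≤ x₁ → 0# ≤ x₂ → x₁ + x₂ ≤ 1# →
    C orderedField k (<⇒≤ 4≤k) x₁ x₂ ≤ C orderedField (suc k) (m≤n⇒m≤1+n (<⇒≤ 4≤k)) x₁ x₂
lemma6p5 R (suc (suc (suc (suc n)))) (s≤s (s≤s (s≤s (s≤s z≤n)))) x₁ x₂ 0≤x₁ 0≤x₂ x₁+x₂≤1 =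
  -- With k = 4 + n, the two sides unfold to `d` with 2 + n and 3 + n equal shares of s.
  d-mono n (complement-nonNeg x₁+x₂≤1) (complement≤1 0≤x₁ 0≤x₂)
  where open OrderedFieldProperties (Reals.orderedField R)
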